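{- Let $G$ and $H$ be simple connected graphs, each with at least two vertices. Then the Kronecker product $G \otimes H$ is not isomorphic to the lexicographic product $G \circ H$.
   Context: All graphs are finite, undirected and simple (no loops or multiple edges). For graphs $G$ and $H$, the following products have vertex set $V(G)\times V(H)$. The Kronecker (direct) product $G\otimes H$: $(x,y)\sim(x',y')$ if $x\sim x'$ in $G$ and $y\sim y'$ in $H$. The lexicographic product $G\circ H$: $(x,y)\sim(x',y')$ if either $x\sim x'$ in $G$, or ($x=x'$ and $y\sim y'$ in $H$). Two graphs are isomorphic if there is a bijection between their vertex sets that preserves adjacency and non-adjacency. -}

module Defs where

open import Data.Nat.Base using (ℕ; _*_)
open import Data.Fin.Base using (Fin)
open import Data.Fin.Properties using (*↔×; inj⇒≟)
open import Data.Product.Base using (_×_; _,_)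
open import Data.Product.Function.NonDependent.Propositional using (_×-↔_)
open import Data.Sum.Base using (_⊎_; inj₁; inj₂)
open import Function.Bundles using (_↔_; Inverse)
open import Function.Construct.Composition using (_↔-∘_)
open import Function.Properties.Inverse using (↔-sym; ↔⇒↣)
open import Relation.Binary.Construct.Closure.ReflexiveTransitive using (Star)
open import Relation.Binary.Core using (Rel)
open import Relation.Binary.Definitions
  using (Decidable; DecidableEquality; Irreflexive; Symmetric)
open import Relation.Binary.PropositionalEquality.Core using (_≡_; refl; sym)
open import Relation.Nullary.Decidable.Core using (_×-dec_; _⊎-dec_)
open import Relation.Nullary.Negation.Core using (¬_)
open import Level using (0ℓ)

-- Adjacency is a relation that only ever matters up to inhabitation, so there
-- are no multiple edges.  Decidability is what makes the edge set finite
-- constructively; classically it is no restriction.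
record Graph : Set₁ where
  field
    V          : Set
    order      : ℕ
    enumerate  : V ↔ Fin order
    Adj        : Rel V 0ℓ
    adj?       : Decidable Adj
    adj-sym    : Symmetric Adj
    adj-irrefl : Irreflexive _≡_ Adj

  _≟ᵥ_ : DecidableEquality V
  _≟ᵥ_ = inj⇒≟ (↔⇒↣ enumerate)

open Graph public using (V; order; Adj)

Connected : Graph → Set
Connected G = ∀ (x y : V G) → Star (Adj G) x y

private
  enumerate-× : (G H : Graph) → (V G × V H) ↔ Fin (order G * order H)
  enumerate-× G H =
    ↔-sym *↔× ↔-∘ (Graph.enumerate G ×-↔ Graph.enumerate H)

infixl 7 _⊗_ _⊚_

_⊗_ : Graph → Graph → Graph
G ⊗ H = record
  { V          = V G × V H
  ; order      = order G * order H
  ; enumerate  = enumerate-× G H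
  ; Adj        = λ (x , y) (x′ , y′) → Adj G x x′ × Adj H y y′
  ; adj?       = λ (x , y) (x′ , y′) → G.adj? x x′ ×-dec H.adj? y y′
  ; adj-sym    = λ (p , q) → G.adj-sym p , H.adj-sym q
  ; adj-irrefl = λ { refl (p , _) → G.adj-irrefl refl p }
  }
  where
  module G = Graph G
  module H = Graph H

-- Lexicographic product; the name avoids a clash with function composition.
_⊚_ : Graph → Graph → Graph
G ⊚ H = record
  { V          = V G × V H
  ; order      = order G * order H
  ; enumerate  = enumerate-× G H
  ; Adj        = λ (x , y) (x′ , y′) → Adj G x x′ ⊎ (x ≡ x′ × Adj H y y′)
  ; adj?       = λ (x , y) (x′ , y′) →
                   G.adj? x x′ ⊎-dec ((x G.≟ᵥ x′) ×-dec H.adj? y y′)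
  ; adj-sym    = λ { (inj₁ p)       → inj₁ (G.adj-sym p)
                   ; (inj₂ (e , q)) → inj₂ (sym e , H.adj-sym q) }
  ; adj-irrefl = λ { refl (inj₁ p)       → G.adj-irrefl refl p
                   ; refl (inj₂ (_ , q)) → H.adj-irrefl refl q }
  }
  where
  module G = Graph G
  module H = Graph H

infix 4 _≅_

record _≅_ (G H : Graph) : Set where
  field
    bijection : V G ↔ V H

  open Inverse bijection public using (to; from)

  field
    preserves-adj    : ∀ {x y} → Adj G x y → Adj H (to x) (to y)
    preserves-nonadj : ∀ {x y} → ¬ Adj G x y → ¬ Adj H (to x) (to y)

{-# OPTIONS --safe #-}

-- On the common vertex set V(G) × V(H), the edges of G ⊗ H form a proper subset
-- of those of G ∘ H: an edge x ∼ x′ of G makes (x , y) and (x′ , y) adjacent in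
-- G ∘ H only.  An isomorphism would permute the finite set of vertex pairs,
-- sending the larger edge set into the smaller.  Following the orbit of the
-- extra edge under this permutation, it lands in the smaller set after one step
-- and stays there, yet must return to where it started.
module Submission where

open import Defs
open import Data.Fin.Base using (Fin; toℕ; fromℕ<)
open import Data.Fin.Properties using (pigeonhole; *↔×; toℕ-fromℕ<)
open import Data.Nat.Base using (ℕ; zero; suc; _≤_; _<_; s≤s⁻¹; _*_)
open import Data.Nat.GeneralisedArithmetic using (fold)
open import Data.Nat.Properties using (n<1+n; <-trans)
open import Data.Product.Base using (∃₂; ∃-syntax; _×_; _,_; proj₁; proj₂)
open import Data.Product.Function.NonDependent.Propositional using (_×-↔_)
open import Data.Sum.Base using (inj₁)
open import Function.Base using (_∘_)
open import Function.Bundles using (_↔_; _↣_; Injection; Inverse)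
open import Function.Construct.Composition using (_↔-∘_)
open import Function.Definitions using (Injective)
open import Function.Properties.Inverse using (↔-sym; ↔⇒↣)
open import Relation.Binary.Construct.Closure.ReflexiveTransitive using (Star; ε; _◅_)
open import Relation.Binary.PropositionalEquality
  using (_≡_; _≢_; refl; sym; trans; cong; subst; subst₂)
open import Relation.Nullary.Decidable.Core using (decidable-stable)
open import Relation.Nullary.Negation.Core using (¬_; contradiction)
open import Relation.Unary using (Pred; _⊆_)

module _ {A : Set} {n : ℕ} (A↣Fin : A ↣ Fin n)
         {f : A → A} (f-injective : Injective _≡_ _≡_ f) where

  private
    fold-cancel : ∀ {x i j} → i < j → fold x f i ≡ fold x f j →
                  ∃[ k ] fold x f (suc k) ≡ x
    fold-cancel {i = zero}  {suc j} _   eq = j , sym eq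
    fold-cancel {i = suc i} {suc j} i<j eq = fold-cancel (s≤s⁻¹ i<j) (f-injective eq)

  -- Among `suc n` iterates two coincide, and injectivity strips their common applications of `f`.
  -- The period is written `suc k` because a return after zero steps would say nothing.
  injective⇒recurrent : ∀ x → ∃[ k ] fold x f (suc k) ≡ x
  injective⇒recurrent x
    with pigeonhole (n<1+n n) (Injection.to A↣Fin ∘ fold x f ∘ toℕ)
  ... | _ , _ , i<j , eq = fold-cancel i<j (Injection.injective A↣Fin eq)

  -- Takes the place of comparing the cardinalities of `P` and `Q`.
  injective-shrinking⇒⊇ : ∀ {p q} {P : Pred A p} {Q : Pred A q} →
                          P ⊆ Q → (∀ {x} → Q x → P (f x)) → Q ⊆ P
  injective-shrinking⇒⊇ {P = P} {Q} P⊆Q shrink {x} Qx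
    with k , eq ← injective⇒recurrent x = subst P eq (orbit k)
    where
    orbit : ∀ k → P (fold x f (suc k))
    orbit zero    = shrink Qx
    orbit (suc k) = shrink (P⊆Q (orbit k))

-- Contrapositive of `preserves-nonadj`; decidability of adjacency removes the double negation.
≅-adj⁻¹ : ∀ {G H} (G≅H : G ≅ H) {x y} → Adj H x y →
          Adj G (_≅_.from G≅H x) (_≅_.from G≅H y)
≅-adj⁻¹ {G} {H} G≅H {x} {y} x∼y =
  decidable-stable (Graph.adj? G _ _) λ ¬adj →
    preserves-nonadj ¬adj
      (subst₂ (Adj H) (sym (strictlyInverseˡ x)) (sym (strictlyInverseˡ y)) x∼y)
  where
  open _≅_ G≅H
  open Inverse bijection using (strictlyInverseˡ)

vertex : ∀ G → 1 ≤ order G → V G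
vertex G 1≤n = Inverse.from (Graph.enumerate G) (fromℕ< 1≤n)

connected⇒edge : ∀ G → Connected G → 2 ≤ order G → ∃₂ (Adj G)
connected⇒edge G conn 2≤n = first-edge (conn u v) u≢v
  where
  open Inverse (Graph.enumerate G) using (from)
  0<n = <-trans (n<1+n 0) 2≤n
  u = vertex G 0<n
  v = from (fromℕ< 2≤n)

  u≢v : u ≢ v
  -- Equal vertices would have equal indices, giving 0 ≡ 1.
  u≢v u≡v with () ← trans (sym (toℕ-fromℕ< 0<n))
    (trans (cong toℕ (Injection.injective (↔⇒↣ (↔-sym (Graph.enumerate G))) u≡v))
           (toℕ-fromℕ< 2≤n))

  first-edge : ∀ {x y} → Star (Adj G) x y → x ≢ y → ∃₂ (Adj G)
  first-edge ε         x≢x = contradiction refl x≢x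
  first-edge (x∼z ◅ _) _   = _ , _ , x∼z

theorem3p7 : (G H : Graph) → Connected G → Connected H →
    2 ≤ order G → 2 ≤ order H → ¬ (G ⊗ H ≅ G ⊚ H)
theorem3p7 G H connG _ 2≤G 2≤H iso
  with x , x′ , x∼x′ ← connected⇒edge G connG 2≤G
  -- As a Kronecker edge, this pair would yield a loop at `y` in `H`.
  = Graph.adj-irrefl H refl (proj₂ (⊚⊆⊗ {(x , y) , (x′ , y)} (inj₁ x∼x′)))
  where
  y = vertex H (<-trans (n<1+n 0) 2≤H)
  W = V G × V H

  pairs : (W × W) ↔ Fin (order (G ⊗ H) * order (G ⊗ H))
  pairs = ↔-sym *↔× ↔-∘ (Graph.enumerate (G ⊗ H) ×-↔ Graph.enumerate (G ⊗ H))

  -- `iso` goes from `⊗` to `⊚`, so its inverse is what carries `E⊚` into `E⊗`.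
  σ : (W × W) ↔ (W × W)
  σ = ↔-sym (_≅_.bijection iso) ×-↔ ↔-sym (_≅_.bijection iso)

  E⊗ E⊚ : Pred (W × W) _
  E⊗ (u , v) = Adj (G ⊗ H) u v
  E⊚ (u , v) = Adj (G ⊚ H) u v

  ⊚⊆⊗ : E⊚ ⊆ E⊗
  -- `inj₁ ∘ proj₁` is the inclusion of `E⊗` in `E⊚`: the `G`-component alone makes a lexicographic
  -- edge.
  ⊚⊆⊗ = injective-shrinking⇒⊇ (↔⇒↣ pairs) (Injection.injective (↔⇒↣ σ))
          {P = E⊗} {Q = E⊚} (inj₁ ∘ proj₁) (≅-adj⁻¹ iso)
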